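{- Let $G$ be a graph of order $n$. If $G$ contains an induced star $K_{1,t}$ with $t\ge 3$, then $\operatorname{st}_{\gamma_{st}}(G)\le n-t+1$.
   Context: All graphs are finite, simple and undirected. For a graph $G=(V,E)$, a set $D\subseteq V$ is a strong dominating set if every vertex $v\in V\setminus D$ is adjacent to some $u\in D$ with $\deg(v)\le\deg(u)$ (degrees taken in $G$). The strong domination number $\gamma_{st}(G)$ is the minimum size of a strong dominating set. For $S\subseteq V$, $G-S$ is the graph obtained by deleting the vertices of $S$. The stability of the strong domination number is $\operatorname{st}_{\gamma_{st}}(G)=\min\{|S| : S\subseteq V,\ \gamma_{st}(G-S)\ne\gamma_{st}(G)\}$. -}

module Defs where

open import Data.Fin.Base using (Fin; zero; suc)
open import Data.Fin.Properties using (all?; any?; nonZeroIndex; suc-injective)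
open import Data.Fin.Subset using (Subset; inside; outside; _∈_; _∉_; ∣_∣; ∁; ⊤)
open import Data.Fin.Subset.Properties
  using (_∈?_; anySubset?; ∈⊤; ∣⊤∣≡n; ∣∁p∣≡n∸∣p∣; x∈p⇒∣p-x∣<∣p∣)
open import Data.Nat.Base using (ℕ; zero; suc; NonZero; _≤_; _<_; _∸_)
open import Data.Nat.Induction using (<-wellFounded)
open import Data.Nat.Properties
  using (_≟_; _≤?_; _<?_; ≮⇒≥; ≤-trans; ≤-reflexive; n∸n≡0; m<n⇒0<n; n≤0⇒n≡0; <⇒≢)
open import Data.Product.Base using (∃; ∃-syntax; _×_; _,_; proj₁; proj₂)
open import Data.Vec.Base using (tabulate; []; _∷_; here; there)
open import Function.Bundles using (_⇔_)
open import Function.Definitions using (Injective)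
open import Induction.WellFounded using (Acc; acc)
open import Level using (0ℓ)
open import Relation.Binary.Core using (Rel)
open import Relation.Binary.Definitions using (Symmetric; Irreflexive)
  renaming (Decidable to Decidable₂)
open import Relation.Binary.PropositionalEquality
  using (_≡_; _≢_; refl; sym; trans; cong; subst)
open import Relation.Nullary.Decidable using (yes; no; does; _×-dec_; _→-dec_; ¬?)
open import Relation.Nullary.Negation using (¬_; contradiction)
open import Relation.Unary using (Pred; Decidable)

private variable
  n m : ℕ

record Graph (n : ℕ) : Set₁ where
  field
    Adj    : Rel (Fin n) 0ℓ
    adj?   : Decidable₂ Adj
    symm   : Symmetric Adj
    irrefl : Irreflexive _≡_ Adj

  neighbourhood : Fin n → Subset n
  neighbourhood v = tabulate (λ u → does (adj? v u))

  deg : Fin n → ℕ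
  deg v = ∣ neighbourhood v ∣

open Graph public

-- The increasing enumeration of the elements of p; the three lemmas below
-- say that it is a bijection from Fin ∣ p ∣ onto p.
element : (p : Subset n) → Fin ∣ p ∣ → Fin n
element (inside  ∷ p) zero    = zero
element (inside  ∷ p) (suc i) = suc (element p i)
element (outside ∷ p) i       = suc (element p i)

element-∈ : (p : Subset n) (i : Fin ∣ p ∣) → element p i ∈ p
element-∈ (inside  ∷ p) zero    = here
element-∈ (inside  ∷ p) (suc i) = there (element-∈ p i)
element-∈ (outside ∷ p) i       = there (element-∈ p i)

element-injective : (p : Subset n) → Injective _≡_ _≡_ (element p)
element-injective (inside  ∷ p) {zero}  {zero}  _  = refl
element-injective (inside  ∷ p) {suc i} {suc j} eq =
  cong suc (element-injective p (suc-injective eq))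
element-injective (outside ∷ p) eq = element-injective p (suc-injective eq)

element-surjective : (p : Subset n) {v : Fin n} → v ∈ p → ∃[ i ] element p i ≡ v
element-surjective (inside  ∷ p) here = zero , refl
element-surjective (inside  ∷ p) (there v∈p) with element-surjective p v∈p
... | i , eq = suc i , cong suc eq
element-surjective (outside ∷ p) (there v∈p) with element-surjective p v∈p
... | i , eq = i , cong suc eq

-- The surviving vertices are renumbered, in increasing order, by Fin ∣ ∁ S ∣.
infixl 6 _-_
_-_ : Graph n → (S : Subset n) → Graph ∣ ∁ S ∣
G - S = record
  { Adj    = λ i j → Adj G (element (∁ S) i) (element (∁ S) j)
  ; adj?   = λ i j → adj? G (element (∁ S) i) (element (∁ S) j)
  ; symm   = symm G
  ; irrefl = λ i≡j → irrefl G (cong (element (∁ S)) i≡j)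
  }

-- m = min { ∣ S ∣ : P S }
IsMinSize : Pred (Subset n) 0ℓ → ℕ → Set
IsMinSize P m = (∃[ S ] P S × ∣ S ∣ ≡ m) × (∀ S → P S → m ≤ ∣ S ∣)

minSize : {P : Pred (Subset n) 0ℓ} → Decidable P → ∃ P → ∃ (IsMinSize P)
minSize {n} {P} P? (S₀ , p₀) = search S₀ p₀ (<-wellFounded ∣ S₀ ∣)
  where
  search : ∀ S → P S → Acc _<_ ∣ S ∣ → ∃ (IsMinSize P)
  search S p (acc rec) with anySubset? (λ T → P? T ×-dec (∣ T ∣ <? ∣ S ∣))
  ... | yes (T , q , T<S) = search T q (rec T<S)
  ... | no ¬smaller       =
    ∣ S ∣ , (S , p , refl) , λ T q → ≮⇒≥ (λ T<S → ¬smaller (T , q , T<S))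

StrongDominating : Graph n → Pred (Subset n) 0ℓ
StrongDominating G D =
  ∀ v → v ∉ D → ∃[ u ] (u ∈ D × Adj G v u × deg G v ≤ deg G u)

strongDominating? : (G : Graph n) → Decidable (StrongDominating G)
strongDominating? G D = all? λ v → ¬? (v ∈? D) →-dec
  any? λ u → (u ∈? D) ×-dec (adj? G v u ×-dec (deg G v ≤? deg G u))

⊤-strongDominating : (G : Graph n) → StrongDominating G ⊤
⊤-strongDominating G v v∉⊤ = contradiction ∈⊤ v∉⊤

γst-min : (G : Graph n) → ∃ (IsMinSize (StrongDominating G))
γst-min G = minSize (strongDominating? G) (⊤ , ⊤-strongDominating G)

γst : Graph n → ℕ
γst G = proj₁ (γst-min G)

γst-isMinSize : (G : Graph n) → IsMinSize (StrongDominating G) (γst G)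
γst-isMinSize G = proj₂ (γst-min G)

γst≤n : (G : Graph n) → γst G ≤ n
γst≤n {n} G = subst (γst G ≤_) (∣⊤∣≡n n)
  (proj₂ (γst-isMinSize G) ⊤ (⊤-strongDominating G))

γst≢0 : (G : Graph n) → Fin n → γst G ≢ 0
γst≢0 G v γ≡0 with γst-isMinSize G
... | (D , dom , ∣D∣≡γ) , _ = ¬v∉D ∉D
  where
  ∉D : ∀ {u} → ¬ (u ∈ D)
  ∉D u∈D = <⇒≢ (m<n⇒0<n (x∈p⇒∣p-x∣<∣p∣ u∈D)) (sym (trans ∣D∣≡γ γ≡0))
  ¬v∉D : ¬ (v ∉ D)
  ¬v∉D v∉D = ∉D (proj₁ (proj₂ (dom v v∉D)))

ChangesγstWhenDeleted : Graph n → Pred (Subset n) 0ℓ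
ChangesγstWhenDeleted G S = γst (G - S) ≢ γst G

changes? : (G : Graph n) → Decidable (ChangesγstWhenDeleted G)
changes? G S = ¬? (γst (G - S) ≟ γst G)

-- Deleting every vertex leaves the null graph, whose γst is 0.
⊤-changes : .{{NonZero n}} → (G : Graph n) → ChangesγstWhenDeleted G ⊤
⊤-changes {n = suc k} G eq = γst≢0 G zero (trans (sym eq) γ[G-⊤]≡0)
  where
  γ[G-⊤]≡0 : γst (G - ⊤) ≡ 0
  γ[G-⊤]≡0 = n≤0⇒n≡0 (≤-trans (γst≤n (G - ⊤)) (≤-reflexive
    (trans (∣∁p∣≡n∸∣p∣ (⊤ {suc k})) (trans (cong (suc k ∸_) (∣⊤∣≡n (suc k))) (n∸n≡0 k)))))

-- For the null graph no S changes γst, so the minimum does not exist; hence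
-- the NonZero argument.
stγst-min : .{{NonZero n}} → (G : Graph n) → ∃ (IsMinSize (ChangesγstWhenDeleted G))
stγst-min G = minSize (changes? G) (⊤ , ⊤-changes G)

stγst : .{{NonZero n}} → Graph n → ℕ
stγst G = proj₁ (stγst-min G)

stγst-isMinSize : .{{_ : NonZero n}} (G : Graph n) →
                  IsMinSize (ChangesγstWhenDeleted G) (stγst G)
stγst-isMinSize G = proj₂ (stγst-min G)

data StarAdj {t : ℕ} : Rel (Fin (suc t)) 0ℓ where
  centre-leaf : ∀ i → StarAdj zero (suc i)
  leaf-centre : ∀ i → StarAdj (suc i) zero

-- K_{1,t}: vertex zero is the centre, the t vertices suc i are the leaves.
star : (t : ℕ) → Graph (suc t)
star t = record
  { Adj    = StarAdj
  ; adj?   = dec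
  ; symm   = λ { (centre-leaf i) → leaf-centre i ; (leaf-centre i) → centre-leaf i }
  ; irrefl = λ { refl () }
  }
  where
  dec : Decidable₂ (StarAdj {t})
  dec zero    zero    = no λ ()
  dec zero    (suc j) = yes (centre-leaf j)
  dec (suc i) zero    = yes (leaf-centre i)
  dec (suc i) (suc j) = no λ ()

-- An induced copy of H in G.
record InducedCopy (H : Graph m) (G : Graph n) : Set where
  field
    embed     : Fin m → Fin n
    injective : Injective _≡_ _≡_ embed
    adj⇔      : ∀ i j → Adj H i j ⇔ Adj G (embed i) (embed j)

open InducedCopy public

-- A graph containing K_{1,t} has a vertex, namely the image of the centre.
order-nonZero : ∀ {t} {G : Graph n} → InducedCopy (star t) G → NonZero n
order-nonZero K = nonZeroIndex (embed K zero)

{-# OPTIONS --safe #-}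

-- Keeping only the star leaves a graph with a universal vertex, so γst ≤ 1;
-- keeping only its t leaves gives an edgeless graph, so γst ≥ t ≥ 3.  At least
-- one of these two deletions changes γst, and each removes at most n ∸ t
-- vertices.
module Submission where

open import Defs
open import Data.Fin.Base using (Fin; zero; suc)
open import Data.Fin.Properties using (any?; injective⇒≤; suc-injective) renaming (_≟_ to _≟ᶠ_)
open import Data.Fin.Subset using (Subset; _∈_; _⊆_; ∣_∣; ∁; ⊤; ⁅_⁆)
open import Data.Fin.Subset.Properties
  using (_∈?_; ∣⊤∣≡n; ∣∁p∣≡n∸∣p∣; p⊆q⇒∣p∣≤∣q∣; x∈⁅x⁆; x∈⁅y⁆⇒x≡y; ∣⁅x⁆∣≡1;
         x∈p⇒x∉∁p; x∈∁p⇒x∉p; x∉∁p⇒x∈p; x∉p⇒x∈∁p)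
open import Data.Nat.Base using (ℕ; NonZero; _≤_; _≥_; _+_; _∸_; s≤s; z≤n)
open import Data.Nat.Properties
  using (_≟_; ≤-trans; ≤-reflexive; m≤m+n; n≤1+n; ∸-monoʳ-≤; <⇒≱; module ≤-Reasoning)
open import Data.Product.Base using (∃-syntax; _,_; proj₁; proj₂)
open import Data.Vec.Base using (tabulate)
open import Data.Vec.Properties using (lookup∘tabulate; []=⇒lookup; lookup⇒[]=)
open import Function.Base using (_∘_)
open import Function.Bundles using (Equivalence)
open import Function.Definitions using (Injective)
open import Level using (0ℓ)
open import Relation.Binary.PropositionalEquality
  using (_≡_; _≢_; refl; sym; trans; cong; subst; subst₂)
open import Relation.Nullary.Decidable using (yes; no; does; dec-true; decidable-stable)
open import Relation.Nullary.Negation using (¬_; contradiction)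
open import Relation.Unary using (Pred; Decidable)

private variable
  n m : ℕ

module _ {P : Pred (Fin n) 0ℓ} (P? : Decidable P) where

  ∈-tabulate⁺ : ∀ {x} → P x → x ∈ tabulate (does ∘ P?)
  ∈-tabulate⁺ {x} px = lookup⇒[]= x _
    (trans (lookup∘tabulate (does ∘ P?) x) (dec-true (P? x) px))

  ∈-tabulate⁻ : ∀ {x} → x ∈ tabulate (does ∘ P?) → P x
  ∈-tabulate⁻ {x} x∈ with P? x | trans (sym (lookup∘tabulate (does ∘ P?) x)) ([]=⇒lookup x∈)
  ... | yes px | _  = px
  ... | no  _  | ()

image : (Fin m → Fin n) → Subset n
image f = tabulate λ v → does (any? λ i → f i ≟ᶠ v)

∈-image⁺ : (f : Fin m → Fin n) (i : Fin m) → f i ∈ image f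
∈-image⁺ f i = ∈-tabulate⁺ (λ v → any? λ i → f i ≟ᶠ v) (i , refl)

∈-image⁻ : (f : Fin m → Fin n) {v : Fin n} → v ∈ image f → ∃[ i ] f i ≡ v
∈-image⁻ f = ∈-tabulate⁻ (λ v → any? λ i → f i ≟ᶠ v)

-- Every value of `f` has a position in the enumeration `element p`, and distinct values have
-- distinct positions; the pigeonhole principle then applies to `Fin m → Fin ∣ p ∣`.
injective⇒≤∣p∣ : {f : Fin m → Fin n} → Injective _≡_ _≡_ f →
                 (p : Subset n) → (∀ i → f i ∈ p) → m ≤ ∣ p ∣
injective⇒≤∣p∣ {f = f} f-inj p f∈p = injective⇒≤ {f = λ i → proj₁ (position i)} λ {i} {j} eq →
  f-inj (trans (sym (proj₂ (position i))) (trans (cong (element p) eq) (proj₂ (position j))))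
  where
  position : ∀ i → ∃[ k ] element p k ≡ f i
  position i = element-surjective p (f∈p i)

-- The singleton of `c` is strong dominating: the degree condition holds because no degree exceeds
-- `n ∸ 1`, and `c`, adjacent to everything else, attains this value.
γst-universal : (G : Graph n) (c : Fin n) → (∀ v → v ≢ c → Adj G v c) → γst G ≤ 1
γst-universal {n} G c universal =
  ≤-trans (proj₂ (γst-isMinSize G) ⁅ c ⁆ dominating) (≤-reflexive (∣⁅x⁆∣≡1 c))
  where
  open ≤-Reasoning

  ∣∁⁅_⁆∣ : ∀ v → ∣ ∁ ⁅ v ⁆ ∣ ≡ n ∸ 1
  ∣∁⁅ v ⁆∣ = trans (∣∁p∣≡n∸∣p∣ ⁅ v ⁆) (cong (n ∸_) (∣⁅x⁆∣≡1 v))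

  neighbourhood⊆ : ∀ v → neighbourhood G v ⊆ ∁ ⁅ v ⁆
  neighbourhood⊆ v u∈N = x∉p⇒x∈∁p λ u∈⁅v⁆ →
    irrefl G (sym (x∈⁅y⁆⇒x≡y v u∈⁅v⁆)) (∈-tabulate⁻ (adj? G v) u∈N)

  ⊆neighbourhood : ∁ ⁅ c ⁆ ⊆ neighbourhood G c
  ⊆neighbourhood {u} u∈ = ∈-tabulate⁺ (adj? G c)
    (symm G (universal u λ { refl → x∈∁p⇒x∉p u∈ (x∈⁅x⁆ c) }))

  deg≤ : ∀ v → deg G v ≤ deg G c
  deg≤ v = begin
    deg G v      ≤⟨ p⊆q⇒∣p∣≤∣q∣ (neighbourhood⊆ v) ⟩
    ∣ ∁ ⁅ v ⁆ ∣  ≡⟨ trans ∣∁⁅ v ⁆∣ (sym ∣∁⁅ c ⁆∣) ⟩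
    ∣ ∁ ⁅ c ⁆ ∣  ≤⟨ p⊆q⇒∣p∣≤∣q∣ ⊆neighbourhood ⟩
    deg G c      ∎

  dominating : StrongDominating G ⁅ c ⁆
  dominating v v∉⁅c⁆ = c , x∈⁅x⁆ c , universal v (λ { refl → v∉⁅c⁆ (x∈⁅x⁆ c) }) , deg≤ v

-- A vertex outside a strong dominating set needs a neighbour inside it, so here a minimum such set
-- contains every vertex.
γst-edgeless : (G : Graph n) → (∀ u v → ¬ Adj G u v) → n ≤ γst G
γst-edgeless {n} G edgeless with γst-isMinSize G
... | (D , dominating , ∣D∣≡γ) , _ =
  subst₂ _≤_ (∣⊤∣≡n n) ∣D∣≡γ (p⊆q⇒∣p∣≤∣q∣ {p = ⊤} λ {v} _ → decidable-stable (v ∈? D) λ v∉D →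
    let u , _ , v~u , _ = dominating v v∉D in edgeless v u v~u)

module _ {P : Subset n} where

  ∁∁⁺ : ∀ {v} → v ∈ P → v ∈ ∁ (∁ P)
  ∁∁⁺ = x∉p⇒x∈∁p ∘ x∈p⇒x∉∁p

  ∁∁⁻ : ∀ {v} → v ∈ ∁ (∁ P) → v ∈ P
  ∁∁⁻ = x∉∁p⇒x∈p ∘ x∈∁p⇒x∉p

-- Keeping exactly `P` is expressed as deleting `∁ P`, so the remaining vertices are enumerated from
-- `∁ (∁ P)`; membership has to be carried back to `P`.
survivor : (P : Subset n) (i : Fin ∣ ∁ (∁ P) ∣) → element (∁ (∁ P)) i ∈ P
survivor P i = ∁∁⁻ (element-∈ (∁ (∁ P)) i)

stγst≤ : .{{_ : NonZero n}} (G : Graph n) (P : Subset n) →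
         γst (G - ∁ P) ≢ γst G → m ≤ ∣ P ∣ → stγst G ≤ n ∸ m
stγst≤ {n} {m} G P changes m≤∣P∣ = begin
  stγst G    ≤⟨ proj₂ (stγst-isMinSize G) (∁ P) changes ⟩
  ∣ ∁ P ∣    ≡⟨ ∣∁p∣≡n∸∣p∣ P ⟩
  n ∸ ∣ P ∣  ≤⟨ ∸-monoʳ-≤ n m≤∣P∣ ⟩
  n ∸ m      ∎
  where open ≤-Reasoning

module _ {t : ℕ} {G : Graph n} (K : InducedCopy (star t) G) where

  leaf : Fin t → Fin n
  leaf i = embed K (suc i)

  leaf-injective : Injective _≡_ _≡_ leaf
  leaf-injective eq = suc-injective (injective K eq)

  t≤γst-leaves : t ≤ γst (G - ∁ (image leaf))
  t≤γst-leaves = ≤-trans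
    (injective⇒≤∣p∣ leaf-injective _ λ i → ∁∁⁺ (∈-image⁺ leaf i))
    (γst-edgeless (G - ∁ (image leaf)) λ u v → independent (survivor _ u) (survivor _ v))
    where
    independent : ∀ {u v} → u ∈ image leaf → v ∈ image leaf → ¬ Adj G u v
    independent u∈ v∈ u~v with ∈-image⁻ leaf u∈ | ∈-image⁻ leaf v∈
    -- Since the copy is induced, an edge between two leaf images would come from an edge between
    -- two leaves of the star.
    ... | i , refl | j , refl with Equivalence.from (adj⇔ K (suc i) (suc j)) u~v
    ... | ()

  γst-star≤1 : γst (G - ∁ (image (embed K))) ≤ 1
  -- `c` is the number that the star's centre receives after the deletion; it is the universal
  -- vertex.
  γst-star≤1 with element-surjective (∁ (∁ (image (embed K)))) (∁∁⁺ (∈-image⁺ (embed K) zero))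
  ... | c , c≡centre = γst-universal (G - ∁ (image (embed K))) c λ v v≢c →
    subst (Adj G _) (sym c≡centre)
      (adjacent (survivor _ v) λ v≡centre →
        v≢c (element-injective (∁ (∁ (image (embed K)))) (trans v≡centre (sym c≡centre))))
    where
    adjacent : ∀ {v} → v ∈ image (embed K) → v ≢ embed K zero → Adj G v (embed K zero)
    adjacent v∈ v≢ with ∈-image⁻ (embed K) v∈
    ... | zero  , refl = contradiction refl v≢
    ... | suc i , refl = Equivalence.to (adj⇔ K (suc i) zero) (leaf-centre i)

theorem3p4 : (n : ℕ) (G : Graph n) (t : ℕ) → t ≥ 3 →
    (K : InducedCopy (star t) G) →
    stγst {{order-nonZero K}} G ≤ n ∸ t + 1
-- The argument gives `n ∸ t`, one better than the stated bound.
theorem3p4 n G t t≥3 K = ≤-trans stγst≤n∸t (m≤m+n (n ∸ t) 1)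
  where
  instance
    n≢0 : NonZero n
    n≢0 = order-nonZero K

  stγst≤n∸t : stγst G ≤ n ∸ t
  stγst≤n∸t with γst (G - ∁ (image (leaf K))) ≟ γst G
  ... | no  leaves-change = stγst≤ G (image (leaf K)) leaves-change
    (injective⇒≤∣p∣ (leaf-injective K) _ (∈-image⁺ (leaf K)))
  ... | yes leaves-same = stγst≤ G (image (embed K)) star-changes
    -- The whole star keeps `suc t` vertices, hence at least `t`.
    (≤-trans (n≤1+n t) (injective⇒≤∣p∣ (injective K) _ (∈-image⁺ (embed K))))
    where
    star-changes : γst (G - ∁ (image (embed K))) ≢ γst G
    -- If neither deletion changed the value, both would leave `γst G`, forcing `t ≤ 1`.
    star-changes star-same = <⇒≱ (≤-trans (s≤s (s≤s z≤n)) t≥3) (begin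
      t                               ≤⟨ t≤γst-leaves K ⟩
      γst (G - ∁ (image (leaf K)))    ≡⟨ trans leaves-same (sym star-same) ⟩
      γst (G - ∁ (image (embed K)))   ≤⟨ γst-star≤1 K ⟩
      1                               ∎)
      where open ≤-Reasoning
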